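{- Let $m\ge 2$. The Lucas numbers are complete mod $m$ if and only if $m\in\{2,4,6,7,14\}$ or $m=3^j$ for some integer $j\ge1$.
   Context: The Lucas numbers are the sequence $L_1=1$, $L_2=3$, $L_{n+1}=L_{n-1}+L_n$ (so $1,3,4,7,11,18,\dots$). A sequence is complete mod $m$ if every residue class modulo $m$ contains some term of the sequence, and defective mod $m$ otherwise. -}

module Defs where

open import Data.Fin.Base using (Fin)
open import Data.Nat.Base using (ℕ; zero; suc; _+_; NonZero)
open import Data.Nat.DivMod using (_mod_)
open import Data.Product.Base using (∃-syntax)
open import Relation.Binary.PropositionalEquality using (_≡_)

-- The sequence L₁, L₂, L₃, … = 1, 3, 4, … starts at index 1, so it is
-- shifted here: lucas k = L_{k+1}.
lucas : ℕ → ℕ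
lucas zero          = 1
lucas (suc zero)    = 3
lucas (suc (suc k)) = lucas k + lucas (suc k)

-- The residue classes modulo m are represented by Fin m.
CompleteMod : (ℕ → ℕ) → (m : ℕ) → .{{NonZero m}} → Set
CompleteMod s m = (r : Fin m) → ∃[ n ] s n mod m ≡ r

{-# OPTIONS --safe #-}

-- Write Lₙ and Fₙ for the Lucas and Fibonacci numbers; Lₙ² - 5Fₙ² = ±4.  Let the sequence be complete mod
-- a prime p other than 2, 3, 7.  One of -1, 7, -7 is a square mod p.  For x = 0, 8/3 or 3/2 respectively,
-- both x² - 4 and x² + 4 are then squares, and x ≡ Lₙ makes one of them equal to 5Fₙ²; so 5 is a square
-- mod p.  But then the golden ratio lies in 𝔽ₚ and, by Fermat, the sequence has period p - 1, which is too
-- short for completeness.  So only 2, 3 and 7 divide a complete modulus, and the products of these are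
-- limited by the defective moduli 8, 12, 18, 21, 28, 49.
--
-- For 3^j, residues are lifted from 3^j to 3^(j+1): there is a shift k (namely 8·3^(j-1)) with
-- L(n+k) ≡ L(n) + 3^j L(n+2) mod 3^(j+1), so if 3 ∤ L(n+2), then L(n), L(n+k) and L(n+2k) are the three
-- lifts of L(n) mod 3^j.
module Submission where

open import Data.Fin.Base as Fin using (Fin; toℕ; fromℕ; fromℕ<; inject₁)
open import Data.Fin.Properties as Fin
  using (toℕ-fromℕ; toℕ-fromℕ<; toℕ-inject₁; toℕ-injective; toℕ<n; all?; any?; pigeonhole)
open import Data.Integer.Base as ℤ using (ℤ; +_; -[1+_]; _+_; _*_; _-_; -_; ∣_∣; 0ℤ; 1ℤ)
open import Data.Integer.Divisibility.Signed using (_∣_; divides; _∣?_; ∣⇒∣ᵤ; ∣ᵤ⇒∣; ∣-trans; *-monoˡ-∣)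
open import Data.Integer.DivMod using (_%ℕ_; _/ℕ_; n%ℕd<d; a≡a%ℕn+[a/ℕn]*n)
import Data.Integer.Properties as ℤ
open import Data.Integer.Tactic.RingSolver using (solve-∀)
open import Data.List.Base using (_∷_; []; length)
open import Data.List.Membership.Propositional using (_∈_)
open import Data.List.Relation.Unary.All using (All; _∷_; [])
open import Data.List.Relation.Unary.Any using (here; there)
open import Data.Nat.Base as ℕ using (ℕ; zero; suc; _≤_; _<_; _^_; _!; z≤n; s≤s; NonZero)
open import Data.Nat.Combinatorics using (_C_; nCn≡1; nCk≡n!/k![n-k]!; k![n∸k]!∣n!)
open import Data.Nat.DivMod as ℕ using (_mod_)
import Data.Nat.Divisibility as ℕ
open import Data.Nat.ListAction using (product)
open import Data.Nat.Primality
  using (Prime; prime?; prime[2]; ¬prime[1]; prime⇒irreducible; prime⇒nonZero; euclidsLemma)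
open import Data.Nat.Primality.Factorisation using (factorise)
import Data.Nat.Properties as ℕ
import Data.Nat.Tactic.RingSolver as ℕSolver
open import Data.Product.Base using (_×_; _,_; proj₁; proj₂; ∃-syntax)
open import Data.Sum.Base as Sum using (_⊎_; inj₁; inj₂; [_,_]′)
open import Function.Base using (_∘_)
open import Function.Bundles using (_⇔_; mk⇔)
open import Relation.Binary.PropositionalEquality
open import Relation.Nullary using (¬_; Dec; yes; no; contradiction)
open import Relation.Nullary.Decidable using (map′; from-yes; from-no)
import Algebra.Properties.CommutativeSemiring.Binomial ℕ.+-*-commutativeSemiring as Binomial
open import Algebra.Properties.Monoid.Sum ℕ.+-0-monoid using (sum; sum-init-last)
open import Algebra.Properties.Semiring.Exp ℕ.+-*-semiring using () renaming (_^_ to _^ˢ_)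
open import Algebra.Properties.Semiring.Mult ℕ.+-*-semiring using () renaming (_×_ to _×ˢ_)
open import Defs

-- Congruences

infix 4 _≡_[mod_]

-- Being a record and not an abbreviation, it lets `x` and `y` be inferred, which `x - y` alone
-- would not determine.
record _≡_[mod_] (x y : ℤ) (m : ℕ) : Set where
  constructor ∣⇒mod
  field mod⇒∣ : + m ∣ x - y

open _≡_[mod_]

∣-scale : ∀ {d x z} c → d ∣ x → z ≡ c * x → d ∣ z
∣-scale {d} c (divides q refl) refl = divides (c * q) (sym (ℤ.*-assoc c q d))

-- Most congruences below come down to this or `∣-scale`: the difference in question is written as
-- an explicit combination of known multiples of the modulus, and the ring solver checks the
-- polynomial identity.
∣-combine : ∀ {d x y z} a b → d ∣ x → d ∣ y → z ≡ a * x + b * y → d ∣ z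
∣-combine {d} a b (divides q refl) (divides r refl) refl = divides (a * q + b * r) (lemma a b q r d)
  where
  lemma : ∀ a b q r d → a * (q * d) + b * (r * d) ≡ (a * q + b * r) * d
  lemma = solve-∀

mod-refl : ∀ {m} x → x ≡ x [mod m ]
mod-refl x = ∣⇒mod (divides 0ℤ (ℤ.+-inverseʳ x))

mod-sym : ∀ {m} {x y} → x ≡ y [mod m ] → y ≡ x [mod m ]
mod-sym {x = x} {y} (∣⇒mod x≡y) = ∣⇒mod (∣-scale (- 1ℤ) x≡y (lemma x y))
  where
  lemma : ∀ x y → y - x ≡ - 1ℤ * (x - y)
  lemma = solve-∀

mod-trans : ∀ {m} {x y z} → x ≡ y [mod m ] → y ≡ z [mod m ] → x ≡ z [mod m ]
mod-trans {x = x} {y} {z} (∣⇒mod x≡y) (∣⇒mod y≡z) = ∣⇒mod (∣-combine 1ℤ 1ℤ x≡y y≡z (lemma x y z))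
  where
  lemma : ∀ x y z → x - z ≡ 1ℤ * (x - y) + 1ℤ * (y - z)
  lemma = solve-∀

mod-+ : ∀ {m} {x y u v} → x ≡ y [mod m ] → u ≡ v [mod m ] → x + u ≡ y + v [mod m ]
mod-+ {x = x} {y} {u} {v} (∣⇒mod x≡y) (∣⇒mod u≡v) = ∣⇒mod (∣-combine 1ℤ 1ℤ x≡y u≡v (lemma x y u v))
  where
  lemma : ∀ x y u v → (x + u) - (y + v) ≡ 1ℤ * (x - y) + 1ℤ * (u - v)
  lemma = solve-∀

mod-* : ∀ {m} {x y u v} → x ≡ y [mod m ] → u ≡ v [mod m ] → x * u ≡ y * v [mod m ]
mod-* {x = x} {y} {u} {v} (∣⇒mod x≡y) (∣⇒mod u≡v) = ∣⇒mod (∣-combine u y x≡y u≡v (lemma x y u v))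
  where
  lemma : ∀ x y u v → x * u - y * v ≡ u * (x - y) + y * (u - v)
  lemma = solve-∀

mod-^ : ∀ {m} {x y} n → x ≡ y [mod m ] → x ℤ.^ n ≡ y ℤ.^ n [mod m ]
mod-^ zero    x≡y = mod-refl 1ℤ
mod-^ (suc n) x≡y = mod-* x≡y (mod-^ n x≡y)

%ℕ-mod : ∀ x m .{{_ : NonZero m}} → x ≡ + (x %ℕ m) [mod m ]
%ℕ-mod x m = ∣⇒mod (divides (x /ℕ m)
  (trans (cong (_- + (x %ℕ m)) (a≡a%ℕn+[a/ℕn]*n x m)) (lemma (+ (x %ℕ m)) (x /ℕ m * + m))))
  where
  lemma : ∀ r y → (r + y) - r ≡ y
  lemma = solve-∀

%ℕ-≡⇒mod : ∀ x y m .{{_ : NonZero m}} → x %ℕ m ≡ y %ℕ m → x ≡ y [mod m ]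
%ℕ-≡⇒mod x y m eq = mod-trans (subst (λ r → x ≡ + r [mod m ]) eq (%ℕ-mod x m)) (mod-sym (%ℕ-mod y m))

mod⇒%-≡ : ∀ {a b} m .{{_ : NonZero m}} → + a ≡ + b [mod m ] → a ℕ.% m ≡ b ℕ.% m
mod⇒%-≡ {a} {b} m (∣⇒mod (divides (+ q) eq)) = trans (cong (ℕ._% m) a≡b+qm) (ℕ.[m+kn]%n≡m%n b q m)
  where
  lemma : ∀ x y → x ≡ y + (x - y)
  lemma = solve-∀
  a≡b+qm : a ≡ b ℕ.+ q ℕ.* m
  a≡b+qm = ℤ.+-injective (trans (lemma (+ a) (+ b)) (cong (λ z → + b + z) (trans eq (sym (ℤ.pos-* q m)))))
-- With a negative quotient it is `b` that exceeds `a` by a multiple of `m`.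
mod⇒%-≡ {a} {b} m (∣⇒mod (divides -[1+ q ] eq)) = sym (trans (cong (ℕ._% m) b≡a+qm) (ℕ.[m+kn]%n≡m%n a (suc q) m))
  where
  lemma : ∀ x y → y ≡ x - (x - y)
  lemma = solve-∀
  b≡a+qm : b ≡ a ℕ.+ suc q ℕ.* m
  b≡a+qm = ℤ.+-injective (trans (lemma (+ a) (+ b)) (cong (λ z → + a + z)
    (trans (cong -_ eq) (trans (ℤ.neg-distribˡ-* -[1+ q ] (+ m)) (sym (ℤ.pos-* (suc q) m))))))

toℕ-mod : ∀ a m .{{_ : NonZero m}} → toℕ (a mod m) ≡ a ℕ.% m
toℕ-mod a m = toℕ-fromℕ< (ℕ.m%n<n a m)

mod⇒residue-≡ : ∀ {a b} m .{{_ : NonZero m}} → + a ≡ + b [mod m ] → a mod m ≡ b mod m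
mod⇒residue-≡ {a} {b} m a≡b = toℕ-injective (trans (toℕ-mod a m) (trans (mod⇒%-≡ m a≡b) (sym (toℕ-mod b m))))

complete⇒hits : ∀ {s m} .{{_ : NonZero m}} → CompleteMod s m → ∀ x → ∃[ n ] + s n ≡ x [mod m ]
complete⇒hits {s} {m} complete x with complete (fromℕ< (n%ℕd<d x m))
... | n , eq = n , mod-trans (subst (λ r → + s n ≡ + r [mod m ]) sn%m≡r (%ℕ-mod (+ s n) m)) (mod-sym (%ℕ-mod x m))
  where
  sn%m≡r : s n ℕ.% m ≡ x %ℕ m
  sn%m≡r = trans (sym (toℕ-mod (s n) m)) (trans (cong toℕ eq) (toℕ-fromℕ< (n%ℕd<d x m)))

hits⇒complete : ∀ {s m} .{{_ : NonZero m}} → (∀ r → ∃[ n ] + s n ≡ + r [mod m ]) → CompleteMod s m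
hits⇒complete {s} {m} hits r with hits (toℕ r)
... | n , s≡r = n , toℕ-injective (trans (toℕ-mod (s n) m)
    (trans (mod⇒%-≡ m s≡r) (ℕ.m<n⇒m%n≡m (toℕ<n r))))

complete-∣ : ∀ {s m d} .{{_ : NonZero m}} .{{_ : NonZero d}} → d ℕ.∣ m → CompleteMod s m → CompleteMod s d
complete-∣ d∣m complete = hits⇒complete λ r →
  let n , s≡r = complete⇒hits complete (+ r) in n , ∣⇒mod (∣-trans (∣ᵤ⇒∣ d∣m) (mod⇒∣ s≡r))

-- Periodic sequences and the small moduli

periodic-% : ∀ {A : Set} (s : ℕ → A) k .{{_ : NonZero k}} →
  (∀ n → s (n ℕ.+ k) ≡ s n) → ∀ n → s (n ℕ.% k) ≡ s n
periodic-% s k periodic n = sym (trans (cong s (ℕ.m≡m%n+[m/n]*n n k)) (multiple (n ℕ./ k) (n ℕ.% k)))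
  where
  regroup : ∀ n k x → n ℕ.+ (k ℕ.+ x) ≡ n ℕ.+ x ℕ.+ k
  regroup = ℕSolver.solve-∀
  multiple : ∀ q n → s (n ℕ.+ q ℕ.* k) ≡ s n
  multiple zero    n = cong s (ℕ.+-identityʳ n)
  multiple (suc q) n = trans (cong s (regroup n k (q ℕ.* k)))
    (trans (periodic (n ℕ.+ q ℕ.* k)) (multiple q n))

-- Choose an index for each of the `m` residues. Two chosen indices agree mod `k` by pigeonhole, and
-- periodicity then identifies their residues.
short-period⇒¬complete : ∀ {s m k} .{{_ : NonZero m}} .{{_ : NonZero k}} → k < m →
  (∀ n → s (n ℕ.+ k) mod m ≡ s n mod m) → ¬ CompleteMod s m
short-period⇒¬complete {s} {m} {k} k<m periodic complete
  with pigeonhole k<m (λ r → proj₁ (complete r) mod k)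
... | i , j , i<j , same = Fin.<⇒≢ i<j (begin
  i                       ≡⟨ proj₂ (complete i) ⟨
  s (index i) mod m       ≡⟨ reduce (index i) ⟨
  s (index i ℕ.% k) mod m ≡⟨ cong (λ n → s n mod m) same-% ⟩
  s (index j ℕ.% k) mod m ≡⟨ reduce (index j) ⟩
  s (index j) mod m       ≡⟨ proj₂ (complete j) ⟩
  j                       ∎)
  where
  open ≡-Reasoning
  index : Fin m → ℕ
  index r = proj₁ (complete r)
  same-% : index i ℕ.% k ≡ index j ℕ.% k
  same-% = trans (sym (toℕ-mod (index i) k)) (trans (cong toℕ same) (toℕ-mod (index j) k))
  reduce : ∀ n → s (n ℕ.% k) mod m ≡ s n mod m
  reduce = periodic-% (λ n → s n mod m) k periodic

-- lucas takes exponential time to evaluate, so residues are computed from pairs of consecutive ones.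
module Orbit (m : ℕ) .{{_ : NonZero m}} where

  step : ℕ × ℕ → ℕ × ℕ
  step (a , b) = b , (a ℕ.+ b) ℕ.% m

  orbit : ℕ → ℕ × ℕ
  orbit zero    = 1 ℕ.% m , 3 ℕ.% m
  orbit (suc n) = step (orbit n)

  orbit≡lucas : ∀ n → orbit n ≡ (lucas n ℕ.% m , lucas (suc n) ℕ.% m)
  orbit≡lucas zero    = refl
  orbit≡lucas (suc n) = trans (cong step (orbit≡lucas n))
    (cong (lucas (suc n) ℕ.% m ,_) (sym (ℕ.%-distribˡ-+ (lucas n) (lucas (suc n)) m)))

  orbit-residue : ∀ n → proj₁ (orbit n) ≡ toℕ (lucas n mod m)
  orbit-residue n = trans (cong proj₁ (orbit≡lucas n)) (sym (toℕ-mod (lucas n) m))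

  module _ {k : ℕ} .{{_ : NonZero k}} (period : orbit k ≡ orbit 0) where

    -- A pair determines all later pairs, so a single return to the initial pair suffices.
    orbit-periodic : ∀ n → orbit (n ℕ.+ k) ≡ orbit n
    orbit-periodic zero    = period
    orbit-periodic (suc n) = cong step (orbit-periodic n)

    Covers : Set
    Covers = (r : Fin m) → ∃[ i ] proj₁ (orbit (toℕ {k} i)) ≡ toℕ r

    covers⇒complete : Covers → CompleteMod lucas m
    covers⇒complete covers r with covers r
    ... | i , eq = toℕ i , toℕ-injective (trans (sym (orbit-residue (toℕ i))) eq)

    complete⇒covers : CompleteMod lucas m → Covers
    complete⇒covers complete r with complete r
    ... | n , eq = n mod k , (begin
      proj₁ (orbit (toℕ (n mod k))) ≡⟨ cong (proj₁ ∘ orbit) (toℕ-mod n k) ⟩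
      proj₁ (orbit (n ℕ.% k))       ≡⟨ cong proj₁ (periodic-% orbit k orbit-periodic n) ⟩
      proj₁ (orbit n)               ≡⟨ orbit-residue n ⟩
      toℕ (lucas n mod m)           ≡⟨ cong toℕ eq ⟩
      toℕ r                         ∎)
      where open ≡-Reasoning

    -- By periodicity only the first `k` indices have to be searched, which makes the question
    -- finite.
    complete? : Dec (CompleteMod lucas m)
    complete? = map′ covers⇒complete complete⇒covers
      (all? λ r → any? λ i → proj₁ (orbit (toℕ i)) ℕ.≟ toℕ r)

open Orbit using (complete?)

-- Here and below, the number in braces is a period of the sequence modulo the given number; `refl`
-- verifies it by evaluating the orbit.
complete₂ : CompleteMod lucas 2
complete₂ = from-yes (complete? 2 {3} refl)

complete₄ : CompleteMod lucas 4
complete₄ = from-yes (complete? 4 {6} refl)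

complete₆ : CompleteMod lucas 6
complete₆ = from-yes (complete? 6 {24} refl)

complete₇ : CompleteMod lucas 7
complete₇ = from-yes (complete? 7 {16} refl)

complete₁₄ : CompleteMod lucas 14
complete₁₄ = from-yes (complete? 14 {48} refl)

defective₈ : ¬ CompleteMod lucas 8
defective₈ = from-no (complete? 8 {12} refl)

defective₁₂ : ¬ CompleteMod lucas 12
defective₁₂ = from-no (complete? 12 {24} refl)

defective₁₈ : ¬ CompleteMod lucas 18
defective₁₈ = from-no (complete? 18 {24} refl)

defective₂₁ : ¬ CompleteMod lucas 21
defective₂₁ = from-no (complete? 21 {16} refl)

defective₂₈ : ¬ CompleteMod lucas 28
defective₂₈ = from-no (complete? 28 {48} refl)

defective₄₉ : ¬ CompleteMod lucas 49
defective₄₉ = from-no (complete? 49 {112} refl)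

-- Powers of 3

-- L(n+k) = F(k-1) L(n) + F(k) L(n+1), so this says that F(k-1) ≡ 1 + q and F(k) ≡ q mod 3q.
record Shift (q : ℕ) : Set where
  field
    period a b : ℕ
    shift : ∀ n → lucas (n ℕ.+ period) ≡
      lucas n ℕ.+ q ℕ.* ((1 ℕ.+ 3 ℕ.* a) ℕ.* lucas n ℕ.+ (1 ℕ.+ 3 ℕ.* b) ℕ.* lucas (suc n))

shift-3 : Shift 3
-- F(7) = 13 = 1 + 3·4 and F(8) = 21 = 3·7, where 4 = 1 + 3·1 and 7 = 1 + 3·2.
shift-3 = record { period = 8 ; a = 1 ; b = 2 ; shift = λ n →
  trans (cong lucas (ℕ.+-comm n 8)) (lemma (lucas n) (lucas (suc n))) }
  where
  lemma : ∀ x₀ x₁ → let x₂ = x₀ ℕ.+ x₁; x₃ = x₁ ℕ.+ x₂; x₄ = x₂ ℕ.+ x₃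
                        x₅ = x₃ ℕ.+ x₄; x₆ = x₄ ℕ.+ x₅; x₇ = x₅ ℕ.+ x₆ in
    x₆ ℕ.+ x₇ ≡ x₀ ℕ.+ 3 ℕ.* (4 ℕ.* x₀ ℕ.+ 7 ℕ.* x₁)
  lemma = ℕSolver.solve-∀

-- With A = 1 + 3a, B = 1 + 3b and φ² = φ + 1, the shift by k is 1 + 3r(A + Bφ); the new a and b are
-- read off its cube.
shift-triple : ∀ r → Shift (3 ℕ.* r) → Shift (3 ℕ.* (3 ℕ.* r))
shift-triple r record { period = k ; a = a ; b = b ; shift = shift } = record
  { period = k ℕ.+ k ℕ.+ k
  ; a = a ℕ.+ r ℕ.* (A ℕ.* A ℕ.+ B ℕ.* B)
      ℕ.+ r ℕ.* r ℕ.* (A ℕ.* A ℕ.* A ℕ.+ 3 ℕ.* (A ℕ.* B ℕ.* B) ℕ.+ B ℕ.* B ℕ.* B)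
  ; b = b ℕ.+ r ℕ.* (2 ℕ.* (A ℕ.* B) ℕ.+ B ℕ.* B)
      ℕ.+ r ℕ.* r ℕ.* (3 ℕ.* (A ℕ.* A ℕ.* B) ℕ.+ 3 ℕ.* (A ℕ.* B ℕ.* B) ℕ.+ 2 ℕ.* (B ℕ.* B ℕ.* B))
  ; shift = λ n → trans (cong lucas (regroup n k)) (trans (shift (n ℕ.+ k ℕ.+ k))
      (trans (cong₂ step (shift² n) (shift² (suc n))) (lemma r a b (lucas n) (lucas (suc n)))))
  }
  where
  A B : ℕ
  A = 1 ℕ.+ 3 ℕ.* a
  B = 1 ℕ.+ 3 ℕ.* b
  step : ℕ → ℕ → ℕ
  step x y = x ℕ.+ (3 ℕ.* r) ℕ.* (A ℕ.* x ℕ.+ B ℕ.* y)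
  regroup : ∀ n k → n ℕ.+ (k ℕ.+ k ℕ.+ k) ≡ n ℕ.+ k ℕ.+ k ℕ.+ k
  regroup = ℕSolver.solve-∀
  shift² : ∀ n → lucas (n ℕ.+ k ℕ.+ k) ≡
    step (step (lucas n) (lucas (suc n))) (step (lucas (suc n)) (lucas (suc (suc n))))
  shift² n = trans (shift (n ℕ.+ k)) (cong₂ step (shift n) (shift (suc n)))
  -- With M = A + Bφ this is (1 + 3rM)³ = 1 + 9r(M + 3rM² + 3r²M³). The terms after M are multiples
  -- of 3, so both coefficients in the bracket stay ≡ 1 mod 3.
  lemma : ∀ r a b x y → let A = 1 ℕ.+ 3 ℕ.* a; B = 1 ℕ.+ 3 ℕ.* b; z = x ℕ.+ y; w = y ℕ.+ z
                            f = λ u v → u ℕ.+ (3 ℕ.* r) ℕ.* (A ℕ.* u ℕ.+ B ℕ.* v) in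
    f (f (f x y) (f y z)) (f (f y z) (f z w)) ≡
    x ℕ.+ (3 ℕ.* (3 ℕ.* r)) ℕ.*
      ((1 ℕ.+ 3 ℕ.* (a ℕ.+ r ℕ.* (A ℕ.* A ℕ.+ B ℕ.* B)
          ℕ.+ r ℕ.* r ℕ.* (A ℕ.* A ℕ.* A ℕ.+ 3 ℕ.* (A ℕ.* B ℕ.* B) ℕ.+ B ℕ.* B ℕ.* B))) ℕ.* x
       ℕ.+ (1 ℕ.+ 3 ℕ.* (b ℕ.+ r ℕ.* (2 ℕ.* (A ℕ.* B) ℕ.+ B ℕ.* B)
          ℕ.+ r ℕ.* r ℕ.* (3 ℕ.* (A ℕ.* A ℕ.* B) ℕ.+ 3 ℕ.* (A ℕ.* B ℕ.* B) ℕ.+ 2 ℕ.* (B ℕ.* B ℕ.* B)))) ℕ.* y)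
  lemma = ℕSolver.solve-∀

shift-3^ : ∀ j → Shift (3 ^ suc j)
shift-3^ zero    = shift-3
shift-3^ (suc j) = shift-triple (3 ^ j) (shift-3^ j)

trichotomy-3 : ∀ x → (+ 3 ∣ x) ⊎ (+ 3 ∣ x - 1ℤ) ⊎ (+ 3 ∣ x + 1ℤ)
trichotomy-3 x with x %ℕ 3 | n%ℕd<d x 3 | %ℕ-mod x 3
... | 0 | _ | ∣⇒mod 3∣x-0 = inj₁ (subst (+ 3 ∣_) (ℤ.+-identityʳ x) 3∣x-0)
... | 1 | _ | ∣⇒mod 3∣x-1 = inj₂ (inj₁ 3∣x-1)
... | 2 | _ | ∣⇒mod 3∣x-2 = inj₂ (inj₂ (∣-combine 1ℤ 1ℤ 3∣x-2 (divides 1ℤ refl) (lemma x)))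
  where
  lemma : ∀ x → x + 1ℤ ≡ 1ℤ * (x - + 2) + 1ℤ * + 3
  lemma = solve-∀
... | suc (suc (suc _)) | s≤s (s≤s (s≤s ())) | _

-- Since `c` ≡ ±1 mod 3, the three terms run through all residues mod 3.
progression-3 : ∀ x {c} → ¬ (+ 3 ∣ c) → (+ 3 ∣ x) ⊎ (+ 3 ∣ x + c) ⊎ (+ 3 ∣ x + c + c)
progression-3 x {c} 3∤c with trichotomy-3 x | trichotomy-3 c
... | inj₁ 3∣x          | _                 = inj₁ 3∣x
... | _                 | inj₁ 3∣c          = contradiction 3∣c 3∤c
... | inj₂ (inj₁ 3∣x-1) | inj₂ (inj₂ 3∣c+1) = inj₂ (inj₁ (∣-combine 1ℤ 1ℤ 3∣x-1 3∣c+1 (lemma x c)))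
  where
  lemma : ∀ x c → x + c ≡ 1ℤ * (x - 1ℤ) + 1ℤ * (c + 1ℤ)
  lemma = solve-∀
... | inj₂ (inj₂ 3∣x+1) | inj₂ (inj₁ 3∣c-1) = inj₂ (inj₁ (∣-combine 1ℤ 1ℤ 3∣x+1 3∣c-1 (lemma x c)))
  where
  lemma : ∀ x c → x + c ≡ 1ℤ * (x + 1ℤ) + 1ℤ * (c - 1ℤ)
  lemma = solve-∀
... | inj₂ (inj₁ 3∣x-1) | inj₂ (inj₁ 3∣c-1) =
  inj₂ (inj₂ (∣-combine 1ℤ 1ℤ (∣-combine 1ℤ (+ 2) 3∣x-1 3∣c-1 refl) (divides 1ℤ refl) (lemma x c)))
  where
  lemma : ∀ x c → x + c + c ≡ 1ℤ * (1ℤ * (x - 1ℤ) + + 2 * (c - 1ℤ)) + 1ℤ * + 3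
  lemma = solve-∀
... | inj₂ (inj₂ 3∣x+1) | inj₂ (inj₂ 3∣c+1) =
  inj₂ (inj₂ (∣-combine 1ℤ (- 1ℤ) (∣-combine 1ℤ (+ 2) 3∣x+1 3∣c+1 refl) (divides 1ℤ refl) (lemma x c)))
  where
  lemma : ∀ x c → x + c + c ≡ 1ℤ * (1ℤ * (x + 1ℤ) + + 2 * (c + 1ℤ)) + - 1ℤ * + 3
  lemma = solve-∀

-- A solution n of L(n) ≡ r mod q can be lifted to one mod 3q when 3 ∤ L(n+2), since L(n+2) is mod 3
-- the increment of (L(n) - r)/q under the shift.
Hit : ℕ → ℤ → Set
Hit q r = ∃[ n ] (+ lucas n ≡ r [mod q ] × ¬ (+ 3 ∣ + lucas (suc (suc n))))

module Lift (s : ℕ) (shifting : Shift (3 ℕ.* s)) where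
  open Shift shifting renaming (period to k)

  q : ℕ
  q = 3 ℕ.* s

  slope : ℕ → ℤ
  slope n = + ((1 ℕ.+ 3 ℕ.* a) ℕ.* lucas n ℕ.+ (1 ℕ.+ 3 ℕ.* b) ℕ.* lucas (suc n))

  lucas-shift : ∀ n → + lucas (n ℕ.+ k) ≡ + lucas n + slope n * + q
  lucas-shift n = trans (cong +_ (shift n)) (cong (λ z → + lucas n + z)
    (trans (ℤ.pos-* q _) (ℤ.*-comm (+ q) (slope n))))

  -- Both coefficients in `slope` are ≡ 1 mod 3, and the recurrence adds the two terms.
  slope-mod-3 : ∀ n → slope n ≡ + lucas (suc (suc n)) [mod 3 ]
  slope-mod-3 n = ∣⇒mod (divides (+ t) (begin
    slope n - + lucas (suc (suc n))
      ≡⟨ cong (λ z → + z - + lucas (suc (suc n))) (expand a b (lucas n) (lucas (suc n))) ⟩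
    + (t ℕ.* 3) + + lucas (suc (suc n)) - + lucas (suc (suc n))
      ≡⟨ cancel (+ (t ℕ.* 3)) (+ lucas (suc (suc n))) ⟩
    + (t ℕ.* 3)
      ≡⟨ ℤ.pos-* t 3 ⟩
    + t * + 3 ∎))
    where
    open ≡-Reasoning
    t : ℕ
    t = a ℕ.* lucas n ℕ.+ b ℕ.* lucas (suc n)
    expand : ∀ a b x y → (1 ℕ.+ 3 ℕ.* a) ℕ.* x ℕ.+ (1 ℕ.+ 3 ℕ.* b) ℕ.* y ≡
      (a ℕ.* x ℕ.+ b ℕ.* y) ℕ.* 3 ℕ.+ (x ℕ.+ y)
    expand = ℕSolver.solve-∀
    cancel : ∀ x y → x + y - y ≡ x
    cancel = solve-∀

  -- Because 3 divides `q`. Hence neither the slope mod 3 nor the condition of `Hit` changes under a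
  -- shift, and shifts can be iterated.
  lucas-shift-mod-3 : ∀ n → + lucas (n ℕ.+ k) ≡ + lucas n [mod 3 ]
  lucas-shift-mod-3 n = ∣⇒mod (divides (slope n * + s) (begin
    + lucas (n ℕ.+ k) - + lucas n                  ≡⟨ cong (_- + lucas n) (lucas-shift n) ⟩
    + lucas n + slope n * + q - + lucas n          ≡⟨ cong (λ z → + lucas n + slope n * z - + lucas n) (ℤ.pos-* 3 s) ⟩
    + lucas n + slope n * (+ 3 * + s) - + lucas n  ≡⟨ lemma (+ lucas n) (slope n) (+ s) ⟩
    slope n * + s * + 3                            ∎))
    where
    open ≡-Reasoning
    lemma : ∀ x c s → x + c * (+ 3 * s) - x ≡ c * s * + 3
    lemma = solve-∀

  slope-shift : ∀ n → slope (n ℕ.+ k) ≡ slope n [mod 3 ]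
  slope-shift n =
    mod-trans (slope-mod-3 (n ℕ.+ k)) (mod-trans (lucas-shift-mod-3 (suc (suc n))) (mod-sym (slope-mod-3 n)))

  ∤-shift : ∀ n → ¬ (+ 3 ∣ + lucas n) → ¬ (+ 3 ∣ + lucas (n ℕ.+ k))
  ∤-shift n 3∤ 3∣ =
    3∤ (∣-combine 1ℤ (- 1ℤ) 3∣ (mod⇒∣ (lucas-shift-mod-3 n)) (lemma (+ lucas n) (+ lucas (n ℕ.+ k))))
    where
    lemma : ∀ x y → x ≡ 1ℤ * y + - 1ℤ * (y - x)
    lemma = solve-∀

  ∣-3q : ∀ x {y} → y ≡ x * + q → + 3 ∣ x → + (3 ℕ.* q) ∣ y
  ∣-3q x refl 3∣x = subst (_∣ x * + q) (sym (ℤ.pos-* 3 q)) (*-monoˡ-∣ (+ q) 3∣x)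

  shift-offset : ∀ n r x → + lucas n - r ≡ x * + q → + lucas (n ℕ.+ k) - r ≡ (x + slope n) * + q
  shift-offset n r x eq = begin
    + lucas (n ℕ.+ k) - r           ≡⟨ cong (_- r) (lucas-shift n) ⟩
    + lucas n + slope n * + q - r   ≡⟨ swap (+ lucas n) (slope n * + q) r ⟩
    + lucas n - r + slope n * + q   ≡⟨ cong (_+ slope n * + q) eq ⟩
    x * + q + slope n * + q         ≡⟨ ℤ.*-distribʳ-+ (+ q) x (slope n) ⟨
    (x + slope n) * + q             ∎
    where
    open ≡-Reasoning
    swap : ∀ l y r → l + y - r ≡ l - r + y
    swap = solve-∀

  ∤-slope : ∀ n → ¬ (+ 3 ∣ + lucas (suc (suc n))) → ¬ (+ 3 ∣ slope n)
  ∤-slope n 3∤ 3∣slope =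
    3∤ (∣-combine 1ℤ (- 1ℤ) 3∣slope (mod⇒∣ (slope-mod-3 n)) (lemma (slope n) (+ lucas (suc (suc n)))))
    where
    lemma : ∀ x y → y ≡ 1ℤ * x + - 1ℤ * (x - y)
    lemma = solve-∀

  -- At n, n + k and n + 2k the quotient of `lucas` minus `r` by `q` is x, x + c and x + c + d,
  -- where c and d are slopes with d ≡ c ≢ 0 mod 3. One of the three is divisible by 3, which gives
  -- the congruence mod 3q.
  lift : ∀ {r} → Hit q r → Hit (3 ℕ.* q) r
  lift {r} (n , ∣⇒mod (divides x eq) , 3∤) with progression-3 x (∤-slope n 3∤)
  ... | inj₁ 3∣x            = n , ∣⇒mod (∣-3q x eq 3∣x) , 3∤
  ... | inj₂ (inj₁ 3∣x+c)   = n ℕ.+ k ,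
    ∣⇒mod (∣-3q (x + slope n) (shift-offset n r x eq) 3∣x+c) ,
    ∤-shift (suc (suc n)) 3∤
  ... | inj₂ (inj₂ 3∣x+c+c) = n ℕ.+ k ℕ.+ k ,
    ∣⇒mod (∣-3q (x + slope n + slope (n ℕ.+ k)) (shift-offset (n ℕ.+ k) r (x + slope n) (shift-offset n r x eq))
      (∣-combine 1ℤ 1ℤ 3∣x+c+c (mod⇒∣ (slope-shift n)) (lemma x (slope n) (slope (n ℕ.+ k))))) ,
    ∤-shift (suc (suc n) ℕ.+ k) (∤-shift (suc (suc n)) 3∤)
    where
    lemma : ∀ x c d → x + c + d ≡ 1ℤ * (x + c + c) + 1ℤ * (d - c)
    lemma = solve-∀

hits-3^ : ∀ j r → Hit (3 ^ suc j) r
hits-3^ zero r with trichotomy-3 r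
-- The values 3, 1 and 11 represent the residues 0, 1 and -1 mod 3; two places later stand 7, 4 and
-- 29, none divisible by 3.
... | inj₁ 3∣r          = 1 , ∣⇒mod (∣-combine 1ℤ (- 1ℤ) (divides 1ℤ refl) 3∣r (lemma r)) , from-no (+ 3 ∣? + 7)
  where
  lemma : ∀ r → + 3 - r ≡ 1ℤ * + 3 + - 1ℤ * r
  lemma = solve-∀
... | inj₂ (inj₁ 3∣r-1) = 0 , ∣⇒mod (∣-scale (- 1ℤ) 3∣r-1 (lemma r)) , from-no (+ 3 ∣? + 4)
  where
  lemma : ∀ r → 1ℤ - r ≡ - 1ℤ * (r - 1ℤ)
  lemma = solve-∀
... | inj₂ (inj₂ 3∣r+1) = 4 , ∣⇒mod (∣-combine (+ 4) (- 1ℤ) (divides 1ℤ refl) 3∣r+1 (lemma r)) , from-no (+ 3 ∣? + 29)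
  where
  lemma : ∀ r → + 11 - r ≡ + 4 * + 3 + - 1ℤ * (r + 1ℤ)
  lemma = solve-∀
hits-3^ (suc j) r = Lift.lift (3 ^ j) (shift-3^ j) (hits-3^ j r)

complete-3^ : ∀ j → CompleteMod lucas (3 ^ suc j) {{ℕ.m^n≢0 3 (suc j)}}
complete-3^ j = hits⇒complete {{ℕ.m^n≢0 3 (suc j)}} λ r → let n , n≡r , _ = hits-3^ j (+ r) in n , n≡r

-- Fermat's little theorem

prime∤! : ∀ {p k} → Prime p → k < p → ¬ (p ℕ.∣ k !)
prime∤! {k = zero}  pr k<p p∣1 = ¬prime[1] (subst Prime (ℕ.∣1⇒≡1 p∣1) pr)
prime∤! {k = suc k} pr k<p p∣ with euclidsLemma (suc k) (k !) pr p∣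
... | inj₁ p∣1+k = ℕ.<⇒≱ k<p (ℕ.∣⇒≤ p∣1+k)
... | inj₂ p∣k!  = prime∤! pr (ℕ.<-trans (ℕ.n<1+n k) k<p) p∣k!

-- `p` divides p! = (p C k) · k! · (p - k)!, but neither factorial, since k and p - k are both below
-- `p`.
prime∣C : ∀ {p k} → Prime p → 0 < k → k < p → p ℕ.∣ p C k
prime∣C {p@(suc p-1)} {k} pr 0<k k<p with euclidsLemma (p C k) (k ! ℕ.* (p ℕ.∸ k) !) pr p∣
  where
  p∣ : p ℕ.∣ (p C k) ℕ.* (k ! ℕ.* (p ℕ.∸ k) !)
  p∣ = subst (p ℕ.∣_) (sym (trans (cong (ℕ._* (k ! ℕ.* (p ℕ.∸ k) !)) (nCk≡n!/k![n-k]! (ℕ.<⇒≤ k<p)))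
    (ℕ.m/n*n≡m {{_}} (k![n∸k]!∣n! (ℕ.<⇒≤ k<p))))) (ℕ.m∣m*n (p-1 !))
... | inj₁ p∣C = p∣C
... | inj₂ p∣rest with euclidsLemma (k !) ((p ℕ.∸ k) !) pr p∣rest
...   | inj₁ p∣k! = contradiction p∣k! (prime∤! pr k<p)
...   | inj₂ p∣[p-k]! = contradiction p∣[p-k]! (prime∤! pr (ℕ.∸-monoʳ-< 0<k (ℕ.<⇒≤ k<p)))

^ˢ≡^ : ∀ x n → x ^ˢ n ≡ x ^ n
^ˢ≡^ x zero    = refl
^ˢ≡^ x (suc n) = cong (x ℕ.*_) (^ˢ≡^ x n)

×ˢ≡* : ∀ n x → n ×ˢ x ≡ n ℕ.* x
×ˢ≡* zero    x = refl
×ˢ≡* (suc n) x = cong (x ℕ.+_) (×ˢ≡* n x)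

∣-sum : ∀ {d n} (t : Fin n → ℕ) → (∀ i → d ℕ.∣ t i) → d ℕ.∣ sum t
∣-sum {n = zero}  t d∣ = _ ℕ.∣0
∣-sum {n = suc n} t d∣ = ℕ.∣m∣n⇒∣m+n (d∣ Fin.zero) (∣-sum (t ∘ Fin.suc) (d∣ ∘ Fin.suc))

-- In the binomial expansion the extreme terms are y^p and x^p, and `p` divides all the others; `c`
-- is their sum divided by `p`.
frobenius : ∀ {p} → Prime p → ∀ x y → ∃[ c ] ((x ℕ.+ y) ^ p ≡ y ^ p ℕ.+ (c ℕ.* p ℕ.+ x ^ p))
frobenius {p@(suc p-1)} pr x y = ℕ.quotient p∣middle , (begin
  (x ℕ.+ y) ^ p                        ≡⟨ ^ˢ≡^ (x ℕ.+ y) p ⟨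
  (x ℕ.+ y) ^ˢ p                         ≡⟨ Binomial.theorem p x y ⟩
  term Fin.zero ℕ.+ sum (term ∘ Fin.suc) ≡⟨ cong₂ ℕ._+_ first (sum-init-last (term ∘ Fin.suc)) ⟩
  y ^ p ℕ.+ (sum middle ℕ.+ term (Fin.suc (fromℕ p-1)))
    ≡⟨ cong (y ^ p ℕ.+_) (cong₂ ℕ._+_ (ℕ._∣_.equality p∣middle) last) ⟩
  y ^ p ℕ.+ (ℕ.quotient p∣middle ℕ.* p ℕ.+ x ^ p) ∎)
  where
  open ≡-Reasoning
  term : Fin (suc p) → ℕ
  term = Binomial.binomialTerm x y p
  middle : Fin p-1 → ℕ
  middle i = term (Fin.suc (inject₁ i))
  first : term Fin.zero ≡ y ^ p
  first = trans (ℕ.+-identityʳ _) (trans (ℕ.*-identityˡ _) (^ˢ≡^ y p))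
  last : term (Fin.suc (fromℕ p-1)) ≡ x ^ p
  last = begin
    term (Fin.suc (fromℕ p-1))
      ≡⟨ cong (λ k → (p C suc k) ×ˢ ((x ^ˢ suc k) ℕ.* (y ^ˢ (p-1 ℕ.∸ k)))) (toℕ-fromℕ p-1) ⟩
    (p C p) ×ˢ ((x ^ˢ p) ℕ.* (y ^ˢ (p-1 ℕ.∸ p-1)))
      ≡⟨ cong₂ (λ c k → c ×ˢ ((x ^ˢ p) ℕ.* (y ^ˢ k))) (nCn≡1 p) (ℕ.n∸n≡0 p-1) ⟩
    1 ×ˢ ((x ^ˢ p) ℕ.* 1) ≡⟨ ℕ.+-identityʳ _ ⟩
    (x ^ˢ p) ℕ.* 1        ≡⟨ ℕ.*-identityʳ _ ⟩
    x ^ˢ p                ≡⟨ ^ˢ≡^ x p ⟩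
    x ^ p                 ∎
  p∣term : ∀ i → p ℕ.∣ middle i
  p∣term i = subst (p ℕ.∣_) (sym (×ˢ≡* (p C suc (toℕ (inject₁ i))) _))
    (ℕ.∣m⇒∣m*n _ (prime∣C pr ℕ.z<s (ℕ.s<s (subst (_< p-1) (sym (toℕ-inject₁ i)) (toℕ<n i)))))
  p∣middle : p ℕ.∣ sum middle
  p∣middle = ∣-sum middle p∣term

fermat-ℕ : ∀ {p} → Prime p → ∀ n → + (n ^ p) ≡ + n [mod p ]
-- Exposing `p` as a successor makes 0^p evaluate to 0.
fermat-ℕ {suc _} pr zero = mod-refl 0ℤ
fermat-ℕ {p} pr (suc n) with frobenius pr 1 n
... | c , eq = ∣⇒mod (∣-combine 1ℤ 1ℤ (mod⇒∣ (fermat-ℕ pr n)) (divides (+ c) refl) (begin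
  + (suc n ^ p) - + suc n                                    ≡⟨ cong (λ z → + z - + suc n) eq ⟩
  + (n ^ p) + (+ (c ℕ.* p) + + (1 ^ p)) - (1ℤ + + n)
    ≡⟨ cong₂ (λ u v → + (n ^ p) + (u + + v) - (1ℤ + + n)) (ℤ.pos-* c p) (ℕ.^-zeroˡ p) ⟩
  + (n ^ p) + (+ c * + p + 1ℤ) - (1ℤ + + n)
    ≡⟨ lemma (+ (n ^ p)) (+ c * + p) (+ n) ⟩
  1ℤ * (+ (n ^ p) - + n) + 1ℤ * (+ c * + p) ∎))
  where
  open ≡-Reasoning
  lemma : ∀ x y n → x + (y + 1ℤ) - (1ℤ + n) ≡ 1ℤ * (x - n) + 1ℤ * y
  lemma = solve-∀

pos-^ : ∀ a n → + (a ^ n) ≡ (+ a) ℤ.^ n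
pos-^ a zero    = refl
pos-^ a (suc n) = trans (ℤ.pos-* a (a ^ n)) (cong (+ a *_) (pos-^ a n))

fermat : ∀ {p} → Prime p → ∀ x → x ℤ.^ p ≡ x [mod p ]
fermat {p} pr x = mod-trans (mod-^ p x≡r) (mod-trans
    (subst (_≡ + r [mod p ]) (pos-^ r p) (fermat-ℕ pr r)) (mod-sym x≡r))
  where
  instance _ = prime⇒nonZero pr
  r : ℕ
  r = x %ℕ p
  x≡r : x ≡ + r [mod p ]
  x≡r = %ℕ-mod x p

euclid : ∀ {p} → Prime p → ∀ x y → + p ∣ x * y → (+ p ∣ x) ⊎ (+ p ∣ y)
euclid pr x y p∣xy with euclidsLemma ∣ x ∣ ∣ y ∣ pr (subst (_ ℕ.∣_) (ℤ.abs-* x y) (∣⇒∣ᵤ p∣xy))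
... | inj₁ p∣x = inj₁ (∣ᵤ⇒∣ p∣x)
... | inj₂ p∣y = inj₂ (∣ᵤ⇒∣ p∣y)

-- Euclid's lemma cancels one factor `x` from Fermat's congruence.
fermat-unit : ∀ {p-1} → Prime (suc p-1) → ∀ {x} → ¬ (+ suc p-1 ∣ x) → x ℤ.^ p-1 ≡ 1ℤ [mod suc p-1 ]
fermat-unit {p-1} pr {x} p∤x = [ (λ p∣x → contradiction p∣x p∤x) , ∣⇒mod ]′
  (euclid pr x (x ℤ.^ p-1 - 1ℤ) (∣-scale 1ℤ (mod⇒∣ (fermat pr x)) (lemma x (x ℤ.^ p-1))))
  where
  lemma : ∀ x y → x * (y - 1ℤ) ≡ 1ℤ * (x * y - x)
  lemma = solve-∀

inverse : ∀ {p} → Prime p → ∀ {x} → ¬ (+ p ∣ x) → ∃[ y ] x * y ≡ 1ℤ [mod p ]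
inverse {suc zero} pr = contradiction pr ¬prime[1]
inverse {suc (suc p-2)} pr {x} p∤x = x ℤ.^ p-2 , fermat-unit pr p∤x

-- Squares mod p

-- For consecutive Fibonacci numbers a, b with `lucas n` = b + 2a, the left side with f = b equals
-- 4(a² + ab - b²). By Cassini's identity the bracket is ±1: it changes sign at each step.
lucas-norm : ∀ n → ∃[ f ]
  (+ lucas n * + lucas n - + 5 * (f * f) ≡ + 4 ⊎ + lucas n * + lucas n - + 5 * (f * f) ≡ - + 4)
lucas-norm n with fibonacci n
  where
  fibonacci : ∀ n → ∃[ a ] ∃[ b ] (+ lucas n ≡ b + + 2 * a × + lucas (suc n) ≡ (a + b) + + 2 * b
    × (a * a + a * b - b * b ≡ 1ℤ ⊎ a * a + a * b - b * b ≡ - 1ℤ))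
  fibonacci zero = 0ℤ , 1ℤ , refl , refl , inj₂ refl
  fibonacci (suc n) with fibonacci n
  ... | a , b , Lₙ , Lₙ₊₁ , norm = b , a + b , Lₙ₊₁ , trans (cong₂ _+_ Lₙ Lₙ₊₁) (lemma a b) , flip norm
    where
    lemma : ∀ a b → (b + + 2 * a) + ((a + b) + + 2 * b) ≡ (b + (a + b)) + + 2 * (a + b)
    lemma = solve-∀
    negate : ∀ a b → b * b + b * (a + b) - (a + b) * (a + b) ≡ - (a * a + a * b - b * b)
    negate = solve-∀
    flip : a * a + a * b - b * b ≡ 1ℤ ⊎ a * a + a * b - b * b ≡ - 1ℤ →
      b * b + b * (a + b) - (a + b) * (a + b) ≡ 1ℤ ⊎ b * b + b * (a + b) - (a + b) * (a + b) ≡ - 1ℤ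
    flip (inj₁ eq) = inj₂ (trans (negate a b) (cong -_ eq))
    flip (inj₂ eq) = inj₁ (trans (negate a b) (cong -_ eq))
... | a , b , Lₙ , _ , norm = b , quadruple norm
  where
  expand : ∀ a b → (b + + 2 * a) * (b + + 2 * a) - + 5 * (b * b) ≡ + 4 * (a * a + a * b - b * b)
  expand = solve-∀
  L²-5b² : + lucas n * + lucas n - + 5 * (b * b) ≡ + 4 * (a * a + a * b - b * b)
  L²-5b² = trans (cong (λ l → l * l - + 5 * (b * b)) Lₙ) (expand a b)
  quadruple : a * a + a * b - b * b ≡ 1ℤ ⊎ a * a + a * b - b * b ≡ - 1ℤ →
    + lucas n * + lucas n - + 5 * (b * b) ≡ + 4 ⊎ + lucas n * + lucas n - + 5 * (b * b) ≡ - + 4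
  quadruple (inj₁ eq) = inj₁ (trans L²-5b² (cong (+ 4 *_) eq))
  quadruple (inj₂ eq) = inj₂ (trans L²-5b² (cong (+ 4 *_) eq))

Square : ℕ → ℤ → Set
Square p a = ∃[ s ] s * s ≡ a [mod p ]

∤-* : ∀ {p} → Prime p → ∀ {x y} → ¬ (+ p ∣ x) → ¬ (+ p ∣ y) → ¬ (+ p ∣ x * y)
∤-* pr {x} {y} p∤x p∤y p∣xy = [ p∤x , p∤y ]′ (euclid pr x y p∣xy)

∤-root : ∀ {p} {x a} → x * x ≡ a [mod p ] → ¬ (+ p ∣ a) → ¬ (+ p ∣ x)
∤-root {x = x} {a} (∣⇒mod x²≡a) p∤a p∣x = p∤a (∣-combine x (- 1ℤ) p∣x x²≡a (lemma x a))
  where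
  lemma : ∀ x a → a ≡ x * x + - 1ℤ * (x * x - a)
  lemma = solve-∀

square-quotient : ∀ {p} → Prime p → ∀ {a} x y → ¬ (+ p ∣ y) → x * x ≡ a * (y * y) [mod p ] → Square p a
square-quotient pr {a} x y p∤y (∣⇒mod x²≡ay²) = let z , ∣⇒mod yz≡1 = inverse pr p∤y in
  x * z , ∣⇒mod (∣-combine (z * z) (a * (y * z + 1ℤ)) x²≡ay² yz≡1 (lemma a x y z))
  where
  lemma : ∀ a x y z → (x * z) * (x * z) - a ≡ z * z * (x * x - a * (y * y)) + a * (y * z + 1ℤ) * (y * z - 1ℤ)
  lemma = solve-∀

-- In the applications `x` is explicit and `y` is an unknown multiple of a Fibonacci number. If `p`
-- divided `y`, it would divide x², hence `x`.
square-ratio : ∀ {p} → Prime p → ∀ {a} x y → ¬ (+ p ∣ x) → x * x ≡ a * (y * y) [mod p ] → Square p a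
square-ratio pr {a} x y p∤x x²≡ay² = square-quotient pr x y p∤y x²≡ay²
  where
  lemma : ∀ a x y → x * x ≡ a * y * y + 1ℤ * (x * x - a * (y * y))
  lemma = solve-∀
  p∤y : ¬ (+ _ ∣ y)
  p∤y p∣y = ∤-* pr p∤x p∤x (∣-combine (a * y) 1ℤ p∣y (mod⇒∣ x²≡ay²) (lemma a x y))

prime-∤ : ∀ {p q} → Prime p → Prime q → p ≢ q → ¬ (+ p ∣ + q)
prime-∤ pr-p pr-q p≢q p∣q with prime⇒irreducible pr-q (∣⇒∣ᵤ p∣q)
... | inj₁ refl = ¬prime[1] pr-p
... | inj₂ p≡q  = p≢q p≡q

prime-odd : ∀ {p} → Prime p → p ≢ 2 → ∃[ h ] p ≡ suc (h ℕ.+ h)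
prime-odd {p} pr p≢2 with p ℕ.% 2 in p%2 | ℕ.m%n<n p 2 | ℕ.m≡m%n+[m/n]*n p 2
... | 0 | _ | _ = contradiction (∣ᵤ⇒∣ (ℕ.m%n≡0⇒n∣m p 2 p%2)) (prime-∤ prime[2] pr (p≢2 ∘ sym))
... | 1 | _ | p≡1+h*2 = p ℕ./ 2 , trans p≡1+h*2 (cong suc (lemma (p ℕ./ 2)))
  where
  lemma : ∀ h → h ℕ.* 2 ≡ h ℕ.+ h
  lemma = ℕSolver.solve-∀
... | suc (suc _) | s≤s (s≤s ()) | _

module _ {h : ℕ} (pr : Prime (suc (h ℕ.+ h))) where

  private
    p : ℕ
    p = suc (h ℕ.+ h)

  -- `p` would divide k - l or k + l, but l - k and k + l both lie strictly between 0 and p = 2h +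
  -- 1.
  distinct-squares : ∀ {k l} → k < l → l ≤ h → ¬ (+ k * + k ≡ + l * + l [mod p ])
  distinct-squares {k} {l} k<l l≤h (∣⇒mod k²≡l²)
    with euclid pr (+ k - + l) (+ k + + l) (∣-scale 1ℤ k²≡l² (lemma (+ k) (+ l)))
    where
    lemma : ∀ x y → (x - y) * (x + y) ≡ 1ℤ * (x * x - y * y)
    lemma = solve-∀
  ... | inj₁ p∣k-l = ℕ.<⇒≢ k<l (begin
    k        ≡⟨ ℕ.m<n⇒m%n≡m (s≤s (ℕ.≤-trans (ℕ.≤-trans (ℕ.<⇒≤ k<l) l≤h) (ℕ.m≤m+n h h))) ⟨
    k ℕ.% p  ≡⟨ mod⇒%-≡ {k} {l} p (∣⇒mod p∣k-l) ⟩
    l ℕ.% p  ≡⟨ ℕ.m<n⇒m%n≡m (s≤s (ℕ.≤-trans l≤h (ℕ.m≤m+n h h))) ⟩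
    l        ∎)
    where open ≡-Reasoning
  ... | inj₂ p∣k+l = ℕ.<⇒≱ (s≤s (ℕ.+-mono-≤ (ℕ.≤-trans (ℕ.<⇒≤ k<l) l≤h) l≤h))
    (ℕ.∣⇒≤ {{ℕ.>-nonZero (ℕ.<-≤-trans (ℕ.≤-<-trans z≤n k<l) (ℕ.m≤n+m l k))}} (∣⇒∣ᵤ p∣k+l))

  module _ {a : ℤ} (b : ℤ) (p∤a : ¬ (+ p ∣ a)) where

    -- If neither a nor b nor ab is a square, the p + 1 values b, 0², …, h², a·1², …, a·h² are distinct mod p.
    value : ℕ → ℤ
    value zero = b
    value (suc k) with k ℕ.≤? h
    ... | yes _ = + k * + k
    ... | no  _ = a * (+ (k ℕ.∸ h) * + (k ℕ.∸ h))

    cancel-a : ∀ x y → a * x ≡ a * y [mod p ] → x ≡ y [mod p ]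
    cancel-a x y (∣⇒mod ax≡ay) = [ (λ p∣a → contradiction p∣a p∤a) , ∣⇒mod ]′
      (euclid pr a (x - y) (∣-scale 1ℤ ax≡ay (lemma a x y)))
      where
      lemma : ∀ a x y → a * (x - y) ≡ 1ℤ * (a * x - a * y)
      lemma = solve-∀

    ∸-bound : ∀ {l} → suc l ≤ p → l ℕ.∸ h ≤ h
    ∸-bound {l} (s≤s l≤h+h) = subst (l ℕ.∸ h ≤_) (ℕ.m+n∸n≡m h h) (ℕ.∸-monoˡ-≤ h l≤h+h)

    ∤-small : ∀ {l} → 0 < l → l ≤ h → ¬ (+ p ∣ + l)
    ∤-small 0<l l≤h p∣l = ℕ.<⇒≱ (s≤s (ℕ.≤-trans l≤h (ℕ.m≤m+n h h))) (ℕ.∣⇒≤ {{ℕ.>-nonZero 0<l}} (∣⇒∣ᵤ p∣l))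

    -- A coincidence b ≡ l² makes b a square, b ≡ ax² gives ab ≡ (ax)², and k² ≡ ax² makes a the
    -- square of k/x. Inside either family `distinct-squares` forbids coincidences, after cancelling
    -- a in the second.
    collision : ∀ {i j} → i < j → j ≤ p → value i ≡ value j [mod p ] →
      Square p a ⊎ Square p b ⊎ Square p (a * b)
    collision {zero} {suc l} i<j j≤p eq with l ℕ.≤? h
    ... | yes _ = inj₂ (inj₁ (+ l , mod-sym eq))
    ... | no  _ = inj₂ (inj₂ (a * + (l ℕ.∸ h) , ∣⇒mod (∣-scale (- a) (mod⇒∣ eq) (lemma a b (+ (l ℕ.∸ h))))))
      where
      lemma : ∀ a b x → (a * x) * (a * x) - a * b ≡ - a * (b - a * (x * x))
      lemma = solve-∀
    collision {suc k} {suc l} (s≤s k<l) j≤p eq with k ℕ.≤? h | l ℕ.≤? h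
    ... | yes k≤h | yes l≤h = contradiction eq (distinct-squares k<l l≤h)
    ... | yes k≤h | no  l≰h = inj₁ (square-quotient pr (+ k) (+ (l ℕ.∸ h))
      (∤-small (ℕ.m<n⇒0<n∸m (ℕ.≰⇒> l≰h)) (∸-bound j≤p)) eq)
    ... | no  k≰h | yes l≤h = contradiction (ℕ.≤-trans (ℕ.<⇒≤ k<l) l≤h) k≰h
    ... | no  k≰h | no  l≰h = contradiction
      (cancel-a (+ (k ℕ.∸ h) * + (k ℕ.∸ h)) (+ (l ℕ.∸ h) * + (l ℕ.∸ h)) eq)
      (distinct-squares (ℕ.∸-monoˡ-< k<l (ℕ.<⇒≤ (ℕ.≰⇒> k≰h))) (∸-bound j≤p))

    square-product-odd : Square p a ⊎ Square p b ⊎ Square p (a * b)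
    square-product-odd with pigeonhole (ℕ.n<1+n p) (λ i → fromℕ< (n%ℕd<d (value (toℕ i)) p))
    ... | i , j , i<j , same = collision i<j (ℕ.s≤s⁻¹ (toℕ<n j))
      (%ℕ-≡⇒mod (value (toℕ i)) (value (toℕ j)) p
        (trans (sym (toℕ-fromℕ< _)) (trans (cong toℕ same) (toℕ-fromℕ< _))))

square-product : ∀ {p} → Prime p → p ≢ 2 → ∀ {a} b → ¬ (+ p ∣ a) → Square p a ⊎ Square p b ⊎ Square p (a * b)
square-product {p} pr p≢2 {a} b p∤a = let h , p≡1+h+h = prime-odd pr p≢2 in odd h p≡1+h+h
  where
  odd : ∀ h → p ≡ suc (h ℕ.+ h) → Square p a ⊎ Square p b ⊎ Square p (a * b)
  odd h refl = square-product-odd {h} pr b p∤a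

-- Prime moduli

module FiveSquare {p : ℕ} .{{_ : NonZero p}} (pr : Prime p) (p≢2 : p ≢ 2) (p≢3 : p ≢ 3) (p≢7 : p ≢ 7)
  (complete : CompleteMod lucas p) where

  p∤2 : ¬ (+ p ∣ + 2)
  p∤2 = prime-∤ pr prime[2] p≢2
  p∤3 : ¬ (+ p ∣ + 3)
  p∤3 = prime-∤ pr (from-yes (prime? 3)) p≢3
  p∤7 : ¬ (+ p ∣ + 7)
  p∤7 = prime-∤ pr (from-yes (prime? 7)) p≢7
  p∤-7 : ¬ (+ p ∣ - + 7)
  p∤-7 p∣-7 = p∤7 (∣-scale (- 1ℤ) p∣-7 refl)
  p∤-1 : ¬ (+ p ∣ - 1ℤ)
  p∤-1 p∣-1 = ¬prime[1] (subst Prime (ℕ.∣1⇒≡1 (∣⇒∣ᵤ p∣-1)) pr)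

  -- Every fraction e/d is a Lucas number mod p, so e² ∓ 4d² = 5(df)² for some f.
  norm-at : ∀ d e → ¬ (+ p ∣ d) →
    ∃[ g ] (e * e - + 4 * (d * d) ≡ + 5 * (g * g) [mod p ] ⊎ e * e - - + 4 * (d * d) ≡ + 5 * (g * g) [mod p ])
  norm-at d e p∤d = let d⁻¹ , dd⁻¹≡1 = inverse pr p∤d
                        n , l≡ed⁻¹  = complete⇒hits {lucas} complete (e * d⁻¹)
                        f , norm    = lucas-norm n
                        dl≡e        = ∣-combine d e (mod⇒∣ l≡ed⁻¹) (mod⇒∣ dd⁻¹≡1) (clear d e (+ lucas n) d⁻¹)
                    in d * f , Sum.map (scale (+ lucas n) f dl≡e) (scale (+ lucas n) f dl≡e) norm
    where
    clear : ∀ d e l y → d * l - e ≡ d * (l - e * y) + e * (d * y - 1ℤ)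
    clear = solve-∀
    factor : ∀ d e l f → e * e - (l * l - + 5 * (f * f)) * (d * d) - + 5 * ((d * f) * (d * f)) ≡
      - (d * l + e) * (d * l - e)
    factor = solve-∀
    scale : ∀ l f {c} → + p ∣ d * l - e → l * l - + 5 * (f * f) ≡ c →
      e * e - c * (d * d) ≡ + 5 * ((d * f) * (d * f)) [mod p ]
    scale l f dl≡e refl = ∣⇒mod (∣-scale (- (d * l + e)) dl≡e (factor d e l f))

  mod-scale-square : ∀ {a} c s → s * s ≡ a [mod p ] → (c * s) * (c * s) ≡ c * c * a [mod p ]
  mod-scale-square {a} c s (∣⇒mod s²≡a) = ∣⇒mod (∣-scale (c * c) s²≡a (lemma a s c))
    where
    lemma : ∀ a s c → (c * s) * (c * s) - c * c * a ≡ c * c * (s * s - a)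
    lemma = solve-∀

  five-square : Square p (+ 5)
  five-square with p ℕ.≟ 5
  -- For p = 5 the square is 0². Otherwise 5 is a unit, as needed below for dividing by 5 and 10.
  ... | yes refl = 0ℤ , ∣⇒mod (divides (- 1ℤ) refl)
  ... | no p≢5 = [ from-[-1] , [ from-7 , from-[-7] ]′ ]′ squares
    where
    p∤5 : ¬ (+ p ∣ + 5)
    p∤5 = prime-∤ pr (from-yes (prime? 5)) p≢5
    squares : Square p (- 1ℤ) ⊎ Square p (+ 7) ⊎ Square p (- + 7)
    squares = square-product pr p≢2 (+ 7) p∤-1
    from-[-1] : Square p (- 1ℤ) → Square p (+ 5)
    -- At 0/1 the two norms are -4 ≡ (2s)² and 4 = 2².
    from-[-1] (s , s²≡-1) = let g , norm = norm-at 1ℤ 0ℤ (p∤-1 ∘ λ p∣1 → ∣-scale (- 1ℤ) p∣1 refl) in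
      [ (λ -4≡5g² → square-ratio pr (+ 2 * s) g (∤-* pr p∤2 (∤-root s²≡-1 p∤-1))
          (mod-trans (mod-scale-square (+ 2) s s²≡-1) -4≡5g²))
      , square-ratio pr (+ 2) g p∤2 ]′ norm
    from-7 : Square p (+ 7) → Square p (+ 5)
    -- At 8/3: 64 - 36 = 28 ≡ (2s)² and 64 + 36 = 10².
    from-7 (s , s²≡7) = let g , norm = norm-at (+ 3) (+ 8) p∤3 in
      [ (λ 28≡5g² → square-ratio pr (+ 2 * s) g (∤-* pr p∤2 (∤-root s²≡7 p∤7))
          (mod-trans (mod-scale-square (+ 2) s s²≡7) 28≡5g²))
      , square-ratio pr (+ 10) g (∤-* pr p∤2 p∤5) ]′ norm
    from-[-7] : Square p (- + 7) → Square p (+ 5)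
    -- At 3/2: 9 - 16 = -7 ≡ s² and 9 + 16 = 5².
    from-[-7] (s , s²≡-7) = let g , norm = norm-at (+ 2) (+ 3) p∤2 in
      [ (λ -7≡5g² → square-ratio pr s g (∤-root s²≡-7 p∤-7) (mod-trans s²≡-7 -7≡5g²))
      , square-ratio pr (+ 5) g p∤5 ]′ norm

-- Binet's formula and the period p - 1

golden-recurrence : ∀ {m} α → α * α ≡ α + 1ℤ [mod m ] → ∀ n → α ℤ.^ suc (suc n) ≡ α ℤ.^ n + α ℤ.^ suc n [mod m ]
golden-recurrence α (∣⇒mod α²≡α+1) n = ∣⇒mod (∣-scale (α ℤ.^ n) α²≡α+1 (lemma α (α ℤ.^ n)))
  where
  lemma : ∀ α x → α * (α * x) - (x + α * x) ≡ x * (α * α - (α + 1ℤ))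
  lemma = solve-∀

-- Both sides satisfy the Lucas recurrence, and they start alike: α + β ≡ 1 and α² + β² ≡ (α + β) +
-- 2 ≡ 3. The exponent is `suc n` because `lucas n` is L(n+1). Nothing is divided by α - β, so the
-- double root mod 5 is covered.
binet : ∀ {m} α β → α * α ≡ α + 1ℤ [mod m ] → β * β ≡ β + 1ℤ [mod m ] → α + β ≡ 1ℤ [mod m ] →
  ∀ n → + lucas n ≡ α ℤ.^ suc n + β ℤ.^ suc n [mod m ]
binet {m} α β α²≡α+1 β²≡β+1 (∣⇒mod α+β≡1) = go
  where
  base₀ : ∀ α β → 1ℤ - (α * 1ℤ + β * 1ℤ) ≡ - 1ℤ * (α + β - 1ℤ)
  base₀ = solve-∀
  base₁ : ∀ α β → + 3 - (α * (α * 1ℤ) + β * (β * 1ℤ)) ≡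
    - 1ℤ * (1ℤ * (α * α - (α + 1ℤ)) + 1ℤ * (β * β - (β + 1ℤ))) + - 1ℤ * (α + β - 1ℤ)
  base₁ = solve-∀
  regroup : ∀ a b c d → (a + b) + (c + d) ≡ (a + c) + (b + d)
  regroup = solve-∀
  go : ∀ n → + lucas n ≡ α ℤ.^ suc n + β ℤ.^ suc n [mod m ]
  go zero       = ∣⇒mod (∣-scale (- 1ℤ) α+β≡1 (base₀ α β))
  go (suc zero) = ∣⇒mod (∣-combine (- 1ℤ) (- 1ℤ)
    (∣-combine 1ℤ 1ℤ (mod⇒∣ α²≡α+1) (mod⇒∣ β²≡β+1) refl) α+β≡1 (base₁ α β))
  go (suc (suc n)) = mod-trans (mod-+ (go n) (go (suc n)))
    (subst (_≡ α ℤ.^ suc (suc (suc n)) + β ℤ.^ suc (suc (suc n)) [mod m ])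
      (regroup (α ℤ.^ suc n) (α ℤ.^ suc (suc n)) (β ℤ.^ suc n) (β ℤ.^ suc (suc n)))
      (mod-sym (mod-+ (golden-recurrence α α²≡α+1 (suc n)) (golden-recurrence β β²≡β+1 (suc n)))))

-- With `s` as √5 and `t` as 1/2, the element is the golden ratio (1 + √5)/2.
golden-root : ∀ {m} s t → s * s ≡ + 5 [mod m ] → + 2 * t ≡ 1ℤ [mod m ] →
  ((1ℤ + s) * t) * ((1ℤ + s) * t) ≡ (1ℤ + s) * t + 1ℤ [mod m ]
golden-root s t (∣⇒mod s²≡5) (∣⇒mod 2t≡1) = ∣⇒mod (∣-combine (t * t) ((+ 3 + s) * t + 1ℤ) s²≡5 2t≡1 (lemma s t))
  where
  lemma : ∀ s t → ((1ℤ + s) * t) * ((1ℤ + s) * t) - ((1ℤ + s) * t + 1ℤ) ≡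
    t * t * (s * s - + 5) + ((+ 3 + s) * t + 1ℤ) * (+ 2 * t - 1ℤ)
  lemma = solve-∀

-- The relation gives α(α - 1) ≡ 1, so `α` is a unit and Fermat's theorem applies.
golden-power : ∀ {p-1} → Prime (suc p-1) → ∀ α → α * α ≡ α + 1ℤ [mod suc p-1 ] →
  ∀ n → α ℤ.^ (n ℕ.+ p-1) ≡ α ℤ.^ n [mod suc p-1 ]
golden-power {p-1} pr α (∣⇒mod α²≡α+1) n =
  subst₂ (λ x y → x ≡ y [mod suc p-1 ]) (sym (ℤ.^-distribˡ-+-* α n p-1)) (ℤ.*-identityʳ (α ℤ.^ n))
    (mod-* (mod-refl (α ℤ.^ n)) (fermat-unit pr p∤α))
  where
  lemma : ∀ α → 1ℤ ≡ (α - 1ℤ) * α + - 1ℤ * (α * α - (α + 1ℤ))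
  lemma = solve-∀
  p∤α : ¬ (+ suc p-1 ∣ α)
  p∤α p∣α = ¬prime[1] (subst Prime (ℕ.∣1⇒≡1 (∣⇒∣ᵤ (∣-combine (α - 1ℤ) (- 1ℤ) p∣α α²≡α+1 (lemma α)))) pr)

lucas-period : ∀ {p-1} → Prime (suc p-1) → suc p-1 ≢ 2 → Square (suc p-1) (+ 5) →
  ∀ n → + lucas (n ℕ.+ p-1) ≡ + lucas n [mod suc p-1 ]
lucas-period {p-1} pr p≢2 (s , s²≡5) n = let t , 2t≡1 = inverse pr (prime-∤ pr prime[2] p≢2) in
  -- The conjugate root is the same expression at `- s`; the trace of the two is 2t ≡ 1.
  period ((1ℤ + s) * t) ((1ℤ + - s) * t) (golden-root s t s²≡5 2t≡1) (golden-root (- s) t (-s²≡5 s²≡5) 2t≡1)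
    (∣⇒mod (∣-scale 1ℤ (mod⇒∣ 2t≡1) (trace s t)))
  where
  p : ℕ
  p = suc p-1
  square-neg : ∀ s → - s * - s ≡ s * s
  square-neg = solve-∀
  -s²≡5 : s * s ≡ + 5 [mod p ] → - s * - s ≡ + 5 [mod p ]
  -s²≡5 = subst (_≡ + 5 [mod p ]) (sym (square-neg s))
  trace : ∀ s t → (1ℤ + s) * t + (1ℤ + - s) * t - 1ℤ ≡ 1ℤ * (+ 2 * t - 1ℤ)
  trace = solve-∀
  period : ∀ α β → α * α ≡ α + 1ℤ [mod p ] → β * β ≡ β + 1ℤ [mod p ] → α + β ≡ 1ℤ [mod p ] →
    + lucas (n ℕ.+ p-1) ≡ + lucas n [mod p ]
  period α β α² β² trace = mod-trans (binet α β α² β² trace (n ℕ.+ p-1)) (mod-trans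
    (mod-+ (golden-power pr α α² (suc n)) (golden-power pr β β² (suc n))) (mod-sym (binet α β α² β² trace n)))

complete⇒p∈2,3,7 : ∀ {p} .{{_ : NonZero p}} → Prime p → CompleteMod lucas p → p ≡ 2 ⊎ p ≡ 3 ⊎ p ≡ 7
complete⇒p∈2,3,7 {1} pr _ = contradiction pr ¬prime[1]
-- Written this way, `p` has a visibly nonzero predecessor, which serves as the period.
complete⇒p∈2,3,7 {p@(suc (suc p-2))} pr complete with p ℕ.≟ 2 | p ℕ.≟ 3 | p ℕ.≟ 7
... | yes p≡2 | _ | _ = inj₁ p≡2
... | no _ | yes p≡3 | _ = inj₂ (inj₁ p≡3)
... | no _ | no _ | yes p≡7 = inj₂ (inj₂ p≡7)
... | no p≢2 | no p≢3 | no p≢7 = contradiction complete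
  (short-period⇒¬complete {lucas} (ℕ.n<1+n (suc p-2)) λ n →
    mod⇒residue-≡ p (lucas-period pr p≢2 (FiveSquare.five-square pr p≢2 p≢3 p≢7 complete) n))

-- Classification

no-prime-divisors⇒1 : ∀ n .{{_ : NonZero n}} → (∀ {p} → Prime p → ¬ (p ℕ.∣ n)) → n ≡ 1
no-prime-divisors⇒1 n none with factorise n
... | record { factors = [] ; isFactorisation = n≡1 } = n≡1
... | record { factors = p ∷ ps ; isFactorisation = refl ; factorsPrime = pr ∷ _ } =
  contradiction (ℕ.m∣m*n (product ps)) (none pr)

sole-prime⇒power : ∀ n q .{{_ : NonZero n}} → (∀ {p} → Prime p → p ℕ.∣ n → p ≡ q) → ∃[ j ] n ≡ q ^ j
sole-prime⇒power n q sole with factorise n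
... | record { factors = ps ; isFactorisation = refl ; factorsPrime = prs } = length ps , power ps prs sole
  where
  power : ∀ ps → All Prime ps → (∀ {p} → Prime p → p ℕ.∣ product ps → p ≡ q) → product ps ≡ q ^ length ps
  power []       []         _    = refl
  power (p ∷ ps) (pr ∷ prs) sole = cong₂ ℕ._*_ (sole pr (ℕ.m∣m*n (product ps)))
    (power ps prs λ pr′ p′∣ → sole pr′ (ℕ.∣n⇒∣m*n p p′∣))

module _ {m : ℕ} .{{_ : NonZero m}} (complete : CompleteMod lucas m) where

  private
    prime-divisor : ∀ {p} → Prime p → p ℕ.∣ m → p ≡ 2 ⊎ p ≡ 3 ⊎ p ≡ 7
    prime-divisor pr p∣m =
      complete⇒p∈2,3,7 {{prime⇒nonZero pr}} pr (complete-∣ {{_}} {{prime⇒nonZero pr}} p∣m complete)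

    -- The factor `k` lets one defective modulus rule out several products below: 42 = 2·21 and 98 =
    -- 2·49, for example.
    excludes : ∀ {d} → .{{_ : NonZero d}} → ¬ CompleteMod lucas d → ∀ k → ¬ (k ℕ.* d ℕ.∣ m)
    excludes {d} defective k kd∣m = defective (complete-∣ (ℕ.∣-trans (ℕ.n∣m*n k) kd∣m) complete)

    -- A prime factor p of `n` is 2, 3 or 7, and then pc divides `m`, which the hypotheses forbid.
    -- So `n` has no prime factor.
    cofactor-trivial : ∀ n c → m ≡ n ℕ.* c → ¬ (2 ℕ.* c ℕ.∣ m) → ¬ (3 ℕ.* c ℕ.∣ m) → ¬ (7 ℕ.* c ℕ.∣ m) → m ≡ c
    cofactor-trivial n c refl ¬2 ¬3 ¬7 = trans (cong (ℕ._* c) n≡1) (ℕ.*-identityˡ c)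
      where
      none : ∀ {p} → Prime p → ¬ (p ℕ.∣ n)
      none pr p∣n with prime-divisor pr (ℕ.∣m⇒∣m*n c p∣n)
      ... | inj₁ refl        = ¬2 (ℕ.*-monoˡ-∣ c p∣n)
      ... | inj₂ (inj₁ refl) = ¬3 (ℕ.*-monoˡ-∣ c p∣n)
      ... | inj₂ (inj₂ refl) = ¬7 (ℕ.*-monoˡ-∣ c p∣n)
      n≡1 : n ≡ 1
      n≡1 = no-prime-divisors⇒1 n {{ℕ.m*n≢0⇒m≢0 n}} none

    nest : ∀ {k c} a → m ≡ k ℕ.* c → (a∣k : a ℕ.∣ k) → m ≡ ℕ.quotient a∣k ℕ.* (a ℕ.* c)
    nest {c = c} a m≡kc (ℕ.divides q refl) = trans m≡kc (ℕ.*-assoc q a c)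

    unnest : ∀ {k c} a .{{_ : NonZero c}} → m ≡ k ℕ.* c → a ℕ.* c ℕ.∣ m → a ℕ.∣ k
    unnest {c = c} a refl ac∣m = ℕ.*-cancelʳ-∣ c ac∣m

  -- The divisibility tests select the largest exceptional divisor c of `m`. Each of 2c, 3c and 7c
  -- is then ruled out by a defective modulus or by a failed test, so m = c. If neither 7 nor 2
  -- divides `m`, only the prime 3 remains.
  complete⇒exceptional⊎power : m ∈ 2 ∷ 4 ∷ 6 ∷ 7 ∷ 14 ∷ [] ⊎ ∃[ j ] m ≡ 3 ^ j
  complete⇒exceptional⊎power with 7 ℕ.∣? m | 2 ℕ.∣? m
  ... | yes (ℕ.divides k m≡7k) | _ with 2 ℕ.∣? k
  ...   | yes 2∣k = inj₁ (there (there (there (there (here (cofactor-trivial (ℕ.quotient 2∣k) 14 (nest 2 m≡7k 2∣k)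
            (excludes defective₂₈ 1) (excludes defective₂₁ 2) (excludes defective₄₉ 2)))))))
  ...   | no  2∤k = inj₁ (there (there (there (here (cofactor-trivial k 7 m≡7k
            (2∤k ∘ unnest 2 m≡7k) (excludes defective₂₁ 1) (excludes defective₄₉ 1))))))
  complete⇒exceptional⊎power | no 7∤m | yes (ℕ.divides k m≡2k) with 2 ℕ.∣? k | 3 ℕ.∣? k
  ...   | yes 2∣k | _ = inj₁ (there (here (cofactor-trivial (ℕ.quotient 2∣k) 4 (nest 2 m≡2k 2∣k)
            (excludes defective₈ 1) (excludes defective₁₂ 1) (excludes defective₂₈ 1))))
  ...   | no 2∤k | yes 3∣k = inj₁ (there (there (here (cofactor-trivial (ℕ.quotient 3∣k) 6 (nest 3 m≡2k 3∣k)
            (excludes defective₁₂ 1) (excludes defective₁₈ 1) (excludes defective₂₁ 2)))))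
  ...   | no 2∤k | no 3∤k = inj₁ (here (cofactor-trivial k 2 m≡2k
            (2∤k ∘ unnest 2 m≡2k) (3∤k ∘ unnest 3 m≡2k) (7∤m ∘ ℕ.∣-trans (ℕ.m∣m*n 2))))
  complete⇒exceptional⊎power | no 7∤m | no 2∤m = inj₂ (sole-prime⇒power m 3 sole)
    where
    sole : ∀ {p} → Prime p → p ℕ.∣ m → p ≡ 3
    sole pr p∣m with prime-divisor pr p∣m
    ... | inj₁ refl        = contradiction p∣m 2∤m
    ... | inj₂ (inj₁ p≡3)  = p≡3
    ... | inj₂ (inj₂ refl) = contradiction p∣m 7∤m

mainTheorem6 : (m : ℕ) .{{_ : NonZero m}} → 2 ≤ m →
    CompleteMod lucas m ⇔ (m ∈ 2 ∷ 4 ∷ 6 ∷ 7 ∷ 14 ∷ [] ⊎ (∃[ j ] (1 ≤ j × m ≡ 3 ^ j)))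
mainTheorem6 m 2≤m = mk⇔ (Sum.map₂ positive ∘ complete⇒exceptional⊎power) from
  where
  positive : ∃[ j ] m ≡ 3 ^ j → ∃[ j ] (1 ≤ j × m ≡ 3 ^ j)
  -- The exponent 0 stands for m = 1.
  positive (zero  , refl) = contradiction 2≤m λ { (s≤s ()) }
  positive (suc j , m≡3^) = suc j , s≤s z≤n , m≡3^
  from : m ∈ 2 ∷ 4 ∷ 6 ∷ 7 ∷ 14 ∷ [] ⊎ (∃[ j ] (1 ≤ j × m ≡ 3 ^ j)) → CompleteMod lucas m
  from (inj₁ (here refl))                                 = complete₂
  from (inj₁ (there (here refl)))                         = complete₄
  from (inj₁ (there (there (here refl))))                 = complete₆
  from (inj₁ (there (there (there (here refl)))))         = complete₇
  from (inj₁ (there (there (there (there (here refl)))))) = complete₁₄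
  from (inj₂ (suc j , _ , refl))                          = complete-3^ j
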